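{- Let $n\ge1$ and fix any $(s,x)\in\{0,1\}^{n+2^n}$ (with $s\in\{0,1\}^n$, $x\in\{0,1\}^{2^n}$). The function $(t,y)\mapsto \mathsf d\mathsf{MUX}_n(s,x;t,y)$, $\{0,1\}^{n+2^n}\to\{0,1\}$, has a monotone De Morgan formula of size at most $(n+1)2^n$.
   Context: $\mathsf{MUX}_n\colon\{0,1\}^{n+2^n}\to\{0,1\}$ is $\mathsf{MUX}_n(s_1,\dots,s_n,x_0,\dots,x_{2^n-1})=x_{\mathrm{bin}(s_1,\dots,s_n)}$, where $\mathrm{bin}(s_1,\dots,s_n)$ is the natural number with binary representation $s_1s_2\cdots s_n$. Let $\mathsf u$ be a third symbol besides $0,1$. A resolution of $\alpha\in\{0,\mathsf u,1\}^m$ is a string $a\in\{0,1\}^m$ with $a_i=\alpha_i$ whenever $\alpha_i\neq\mathsf u$. For $z,w\in\{0,1\}^m$, let $z\oplus\mathsf u\cdot w\in\{0,\mathsf u,1\}^m$ be the string whose $i$-th entry is $z_i$ if $w_i=0$ and $\mathsf u$ if $w_i=1$. The hazard derivative of $f\colon\{0,1\}^m\to\{0,1\}$ is the Boolean function $\mathsf df(z;w)$ on $2m$ variables with $\mathsf df(z;w)=1$ if and only if $f$ is not constant on the set of all resolutions of $z\oplus\mathsf u\cdot w$. For $\mathsf{MUX}_n$ we take $m=n+2^n$, $z=(s,x)$, $w=(t,y)$. A monotone De Morgan formula is a binary tree with internal nodes labeled $\vee$ or $\wedge$ (fan-in two) and leaves labeled by (un-negated) variables; its size is its number of leaves. -}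

module Defs where

open import Data.Bool using (Bool; true; false; _∧_; _∨_; if_then_else_)
import Data.Bool.Properties as Bool
open import Data.Fin using (Fin; fromℕ<)
open import Data.Fin.Properties using (all?)
open import Data.Nat using (ℕ; zero; suc; _+_; _^_; _<_; z≤n; s≤s)
open import Data.Nat.Properties using (≤-trans; m≤m+n; +-monoʳ-<; +-identityʳ)
open import Data.Product using (_,_)
open import Data.Vec using (Vec; []; _∷_; lookup; take; drop; zipWith)
open import Relation.Binary.Definitions using (DecidableEquality)
open import Relation.Binary.PropositionalEquality using (_≡_; _≢_; refl; cong)
open import Relation.Nullary using (¬_; Dec; yes; no; does)
open import Relation.Nullary.Decidable using (map′; ¬?; _→-dec_; _×-dec_)
open import Relation.Unary using (Decidable)

-- The most significant bit comes first.
bin : ∀ {n} → Vec Bool n → ℕ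
bin             []          = 0
bin {n = suc n} (true  ∷ s) = 2 ^ n + bin s
bin             (false ∷ s) = bin s

bin<2^n : ∀ {n} (s : Vec Bool n) → bin s < 2 ^ n
bin<2^n             []          = s≤s z≤n
bin<2^n {n = suc n} (true  ∷ s) rewrite +-identityʳ (2 ^ n) = +-monoʳ-< (2 ^ n) (bin<2^n s)
bin<2^n {n = suc n} (false ∷ s) = ≤-trans (bin<2^n s) (m≤m+n (2 ^ n) _)

MUX : ∀ n → Vec Bool (n + 2 ^ n) → Bool
MUX n v = lookup (drop n v) (fromℕ< (bin<2^n (take n v)))

data Ternary : Set where
  bit : Bool → Ternary
  𝕦   : Ternary

_≟_ : DecidableEquality Ternary
bit a ≟ bit b = map′ (cong bit) (λ { refl → refl }) (a Bool.≟ b)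
bit _ ≟ 𝕦     = no λ ()
𝕦     ≟ bit _ = no λ ()
𝕦     ≟ 𝕦     = yes refl

Resolution : ∀ {m} → Vec Ternary m → Vec Bool m → Set
Resolution α a = ∀ i → lookup α i ≢ 𝕦 → bit (lookup a i) ≡ lookup α i

_⊕𝕦·_ : ∀ {m} → Vec Bool m → Vec Bool m → Vec Ternary m
_⊕𝕦·_ = zipWith λ z w → if w then 𝕦 else bit z

ConstantOn : ∀ {m} → (Vec Bool m → Set) → (Vec Bool m → Bool) → Set
ConstantOn P f = ∀ a b → P a → P b → f a ≡ f b

resolution? : ∀ {m} (α : Vec Ternary m) → Decidable (Resolution α)
resolution? α a =
  all? λ i → ¬? (lookup α i ≟ 𝕦) →-dec (bit (lookup a i) ≟ lookup α i)

∀Vec? : ∀ {m} {P : Vec Bool m → Set} → Decidable P → Dec (∀ v → P v)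
∀Vec? {zero}  P? = map′ (λ { p [] → p }) (λ p → p []) (P? [])
∀Vec? {suc m} P? =
  map′ (λ { (p , q) (true ∷ v) → p v ; (p , q) (false ∷ v) → q v })
       (λ p → (λ v → p (true ∷ v)) , (λ v → p (false ∷ v)))
       (∀Vec? (λ v → P? (true ∷ v)) ×-dec ∀Vec? (λ v → P? (false ∷ v)))

constantOn? : ∀ {m} {P : Vec Bool m → Set} → Decidable P →
              (f : Vec Bool m → Bool) → Dec (ConstantOn P f)
constantOn? P? f =
  ∀Vec? λ a → ∀Vec? λ b → P? a →-dec (P? b →-dec (f a Bool.≟ f b))

nonConstant? : ∀ {m} (f : Vec Bool m → Bool) (z w : Vec Bool m) →
               Dec (¬ ConstantOn (Resolution (z ⊕𝕦· w)) f)
nonConstant? f z w = ¬? (constantOn? (resolution? (z ⊕𝕦· w)) f)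

hazardDerivative : ∀ {m} → (Vec Bool m → Bool) → Vec Bool m → Vec Bool m → Bool
hazardDerivative f z w = does (nonConstant? f z w)

data MonotoneFormula (m : ℕ) : Set where
  var  : Fin m → MonotoneFormula m
  _∧ᶠ_ : MonotoneFormula m → MonotoneFormula m → MonotoneFormula m
  _∨ᶠ_ : MonotoneFormula m → MonotoneFormula m → MonotoneFormula m

eval : ∀ {m} → MonotoneFormula m → Vec Bool m → Bool
eval (var i)  v = lookup v i
eval (F ∧ᶠ G) v = eval F v ∧ eval G v
eval (F ∨ᶠ G) v = eval F v ∨ eval G v

size : ∀ {m} → MonotoneFormula m → ℕ
size (var _)  = 1
size (F ∧ᶠ G) = size F + size G
size (F ∨ᶠ G) = size F + size G

{-# OPTIONS --safe #-}
-- Call an address a reachable if a agrees with s wherever t is 0.  The derivative is 1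
-- exactly if some reachable a has y_a = 1 or x_a ≠ x_s, so it is the disjunction over all
-- addresses a of the conjunction of those t_i with a_i ≠ s_i, together with y_a
-- unless x_a ≠ x_s.  The a-th term has at most d + 1 leaves, where d ≤ n is the Hamming
-- distance of a and s.
module Submission where

open import Defs
open import Data.Bool using (Bool; true; false; not; _∧_; _∨_; _xor_; if_then_else_)
import Data.Bool.Properties as Bool
open import Data.Bool.Properties
  using (∧-assoc; ∧-identityʳ; ∧-distribˡ-∨; ∨-conicalˡ; ∨-conicalʳ; not-¬; ¬-not; xor-same)
open import Data.Fin using (Fin; zero; suc; _↑ˡ_; _↑ʳ_; fromℕ<)
import Data.Fin as Fin
open import Data.Fin.Properties using () renaming (_≟_ to _≟ᶠ_)
open import Data.Nat using (ℕ; suc; _+_; _*_; _^_; _≤_; _≥_)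
open import Data.Nat.Properties
  using (≤-refl; +-mono-≤; m≤m+n; *-identityʳ; module ≤-Reasoning)
open import Data.Nat.Tactic.RingSolver using (solve-∀)
open import Data.Product using (Σ-syntax; ∃-syntax; _×_; _,_)
open import Data.Sum using (inj₁; inj₂)
open import Data.Vec using (Vec; []; _∷_; _++_; lookup; take; drop; updateAt; splitAt)
open import Data.Vec.Properties
  using (++-injective; take++drop≡id; lookup-++ˡ; lookup-++ʳ; lookup-splitAt; lookup-zipWith;
         lookup∘updateAt; lookup∘updateAt′)
open import Function using (_∘_)
open import Relation.Binary.PropositionalEquality
  using (_≡_; _≢_; refl; sym; trans; cong; cong₂; module ≡-Reasoning)
open import Relation.Nullary using (¬_; contradiction; yes; no; proof)
open import Relation.Nullary.Reflects using (Reflects; ofʸ; ofⁿ; det)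

-- Resolutions as agreement outside the unstable positions.

bit-injective : ∀ {b c} → bit b ≡ bit c → b ≡ c
bit-injective refl = refl

-- Resolutions of `z ⊕𝕦· w` with the third symbol eliminated, a form that splits easily along `∷`
-- and `++`.
AgreesOff : ∀ {m} → Vec Bool m → Vec Bool m → Vec Bool m → Set
AgreesOff z w a = ∀ i → lookup w i ≡ false → lookup a i ≡ lookup z i

resolution⇒agreesOff : ∀ {m} (z w a : Vec Bool m) →
                       Resolution (z ⊕𝕦· w) a → AgreesOff z w a
resolution⇒agreesOff z w a r i wᵢ
  with r i
... | rᵢ rewrite lookup-zipWith (λ b c → if c then 𝕦 else bit b) i z w | wᵢ
  = bit-injective (rᵢ λ ())

agreesOff⇒resolution : ∀ {m} (z w a : Vec Bool m) →
                       AgreesOff z w a → Resolution (z ⊕𝕦· w) a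
agreesOff⇒resolution z w a p i α≢𝕦
  rewrite lookup-zipWith (λ b c → if c then 𝕦 else bit b) i z w
  with lookup w i in wᵢ
... | true  = contradiction refl α≢𝕦
... | false = cong bit (p i wᵢ)

agreesOff-refl : ∀ {m} (z w : Vec Bool m) → AgreesOff z w z
agreesOff-refl _ _ _ _ = refl

agreesOff-∷ : ∀ {m b c d} {z w a : Vec Bool m} → (c ≡ false → d ≡ b) →
              AgreesOff z w a → AgreesOff (b ∷ z) (c ∷ w) (d ∷ a)
agreesOff-∷ h p zero    = h
agreesOff-∷ h p (suc i) = p i

agreesOff-++ : ∀ {k l} (s t a : Vec Bool k) (x y z : Vec Bool l) →
               AgreesOff s t a → AgreesOff x y z → AgreesOff (s ++ x) (t ++ y) (a ++ z)
agreesOff-++ {k} s t a x y z p q i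
  rewrite lookup-splitAt k s x i | lookup-splitAt k t y i | lookup-splitAt k a z i
  with Fin.splitAt k i
... | inj₁ j = p j
... | inj₂ j = q j

agreesOff-++⁻ˡ : ∀ {k l} (s t a : Vec Bool k) (x y z : Vec Bool l) →
                 AgreesOff (s ++ x) (t ++ y) (a ++ z) → AgreesOff s t a
agreesOff-++⁻ˡ {l = l} s t a x y z p i
  with p (i ↑ˡ l)
... | pᵢ rewrite lookup-++ˡ s x i | lookup-++ˡ t y i | lookup-++ˡ a z i = pᵢ

agreesOff-++⁻ʳ : ∀ {k l} (s t a : Vec Bool k) (x y z : Vec Bool l) →
                 AgreesOff (s ++ x) (t ++ y) (a ++ z) → AgreesOff x y z
agreesOff-++⁻ʳ {k} s t a x y z p i
  with p (k ↑ʳ i)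
... | pᵢ rewrite lookup-++ʳ s x i | lookup-++ʳ t y i | lookup-++ʳ a z i = pᵢ

agreesOff-flip : ∀ {m} (z w : Vec Bool m) i → lookup w i ≡ true →
                 AgreesOff z w (updateAt z i not)
agreesOff-flip z w i wᵢ j wⱼ with j ≟ᶠ i
... | yes refl = contradiction (trans (sym wᵢ) wⱼ) λ ()
... | no j≢i   = lookup∘updateAt′ j i j≢i z

-- Disjunctions over reachable addresses.

-- Branches on keeping or flipping the bit `b` of `s` rather than on its value: keeping it is always
-- allowed, flipping it requires `c`. Hence no entry of `t` is ever negated.
anyReachable : ∀ {n} → Vec Bool n → Vec Bool n → (Vec Bool n → Bool) → Bool
anyReachable []      []      g = g []
anyReachable (b ∷ s) (c ∷ t) g =
  anyReachable s t (g ∘ (b ∷_)) ∨ (c ∧ anyReachable s t (g ∘ (not b ∷_)))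

anyReachable-true : ∀ {n} (s t : Vec Bool n) g → anyReachable s t g ≡ true →
                    ∃[ a ] AgreesOff s t a × g a ≡ true
anyReachable-true []      []      g eq = [] , (λ ()) , eq
anyReachable-true (b ∷ s) (c ∷ t) g eq
  with anyReachable s t (g ∘ (b ∷_)) in eq₀
... | true = let a , p , ga = anyReachable-true s t (g ∘ (b ∷_)) eq₀
             in b ∷ a , agreesOff-∷ (λ _ → refl) p , ga
... | false with true ← c =
  let a , p , ga = anyReachable-true s t (g ∘ (not b ∷_)) eq
  in not b ∷ a , agreesOff-∷ (λ ()) p , ga

anyReachable-false : ∀ {n} (s t : Vec Bool n) g → anyReachable s t g ≡ false →
                     ∀ a → AgreesOff s t a → g a ≡ false
anyReachable-false []      []          g eq []      p = eq
anyReachable-false (b ∷ s) (c ∷ t) g eq (d ∷ a) p with d Bool.≟ b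
... | yes refl = anyReachable-false s t _ (∨-conicalˡ _ _ eq) a (p ∘ suc)
... | no d≢b with c
...   | false = contradiction (p zero refl) d≢b
...   | true rewrite ¬-not d≢b =
  anyReachable-false s t _ (∨-conicalʳ _ _ eq) a (p ∘ suc)

-- The hazard derivative of the multiplexer as such a disjunction.

address : ∀ {n} → Vec Bool n → Fin (2 ^ n)
address a = fromℕ< (bin<2^n a)

MUX-++ : ∀ {n} (a : Vec Bool n) (z : Vec Bool (2 ^ n)) → MUX n (a ++ z) ≡ lookup z (address a)
MUX-++ {n} a z =
  let take≡ , drop≡ = ++-injective (take n (a ++ z)) a (take++drop≡id n (a ++ z))
  in cong₂ (λ u v → lookup u (address v)) drop≡ take≡

differs : ∀ {n} → Vec Bool n → Vec Bool (2 ^ n) → Vec Bool n → Bool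
differs s x a = lookup x (address a) xor lookup x (address s)

xor-true⇒≢ : ∀ {b c} → b xor c ≡ true → b ≢ c
xor-true⇒≢ {b} eq refl = contradiction (trans (sym eq) (xor-same b)) λ ()

xor-false⇒≡ : ∀ {b c} → b xor c ≡ false → b ≡ c
xor-false⇒≡ {true}  {true}  _ = refl
xor-false⇒≡ {false} {false} _ = refl

module _ {n : ℕ} (s t : Vec Bool n) (x y : Vec Bool (2 ^ n)) where

  private
    g : Vec Bool n → Bool
    g a = differs s x a ∨ lookup y (address a)

    Const : Set
    Const = ConstantOn (Resolution ((s ++ x) ⊕𝕦· (t ++ y))) (MUX n)

  -- Address and data resolve independently, so any reachable address may be paired with any
  -- resolution of the data.
  constant⇒lookup-≡ : Const → ∀ a a′ z z′ → AgreesOff s t a → AgreesOff s t a′ →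
                      AgreesOff x y z → AgreesOff x y z′ →
                      lookup z (address a) ≡ lookup z′ (address a′)
  constant⇒lookup-≡ const a a′ z z′ p p′ q q′ = begin
    lookup z (address a)    ≡⟨ MUX-++ a z ⟨
    MUX n (a ++ z)          ≡⟨ const (a ++ z) (a′ ++ z′) (resolution a z p q)
                                                         (resolution a′ z′ p′ q′) ⟩
    MUX n (a′ ++ z′)        ≡⟨ MUX-++ a′ z′ ⟩
    lookup z′ (address a′)  ∎
    where
    open ≡-Reasoning
    resolution : ∀ a z → AgreesOff s t a → AgreesOff x y z →
                 Resolution ((s ++ x) ⊕𝕦· (t ++ y)) (a ++ z)
    resolution a z p q =
      agreesOff⇒resolution (s ++ x) (t ++ y) (a ++ z) (agreesOff-++ s t a x y z p q)

  reachable⇒nonConstant : ∀ a → AgreesOff s t a → g a ≡ true → ¬ Const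
  reachable⇒nonConstant a p ga const with differs s x a in eq
  -- Keep the data `x` and move the address from `s` to `a`: the selected bit changes.
  ... | true  = xor-true⇒≢ eq
    (constant⇒lookup-≡ const a s x x p (agreesOff-refl s t)
                       (agreesOff-refl x y) (agreesOff-refl x y))
  -- Now `ga` says that `y` is 1 at `address a`, so the address stays `a` and the data bit selected
  -- there is flipped.
  ... | false = not-¬ refl (trans
    (constant⇒lookup-≡ const a a x (updateAt x (address a) not) p p
                       (agreesOff-refl x y) (agreesOff-flip x y (address a) ga))
    (lookup∘updateAt (address a) x))

  -- Every resolution yields the stable value, the bit of `x` at `address s`: where `y` is 0 the
  -- selected bit is still that of `x`, and by `differs` it equals the one selected by `s`.
  unreachable⇒constant : (∀ a → AgreesOff s t a → g a ≡ false) → Const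
  unreachable⇒constant h u v ru rv = trans (MUX-≡ u ru) (sym (MUX-≡ v rv))
    where
    MUX-≡ : ∀ v → Resolution ((s ++ x) ⊕𝕦· (t ++ y)) v → MUX n v ≡ lookup x (address s)
    MUX-≡ v r with a , z , refl ← splitAt n v = begin
      lookup z (address a)  ≡⟨ agreesOff-++⁻ʳ s t a x y z agrees (address a)
                                 (∨-conicalʳ _ _ ga) ⟩
      lookup x (address a)  ≡⟨ xor-false⇒≡ (∨-conicalˡ _ _ ga) ⟩
      lookup x (address s)  ∎
      where
      open ≡-Reasoning
      agrees : AgreesOff (s ++ x) (t ++ y) (a ++ z)
      agrees = resolution⇒agreesOff (s ++ x) (t ++ y) (a ++ z) r
      ga : g a ≡ false
      ga = h a (agreesOff-++⁻ˡ s t a x y z agrees)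

  anyReachable-reflects : Reflects (¬ Const) (anyReachable s t g)
  anyReachable-reflects with anyReachable s t g in eq
  ... | true  = let a , p , ga = anyReachable-true s t g eq
                in ofʸ (reachable⇒nonConstant a p ga)
  ... | false = ofⁿ λ ¬const →
    ¬const (unreachable⇒constant (anyReachable-false s t g eq))

  -- Both Booleans reflect the same proposition `¬ Const`, so they coincide without evaluating the
  -- decision procedure.
  anyReachable≡hazardDerivative :
    anyReachable s t g ≡ hazardDerivative (MUX n) (s ++ x) (t ++ y)
  anyReachable≡hazardDerivative =
    det anyReachable-reflects (proof (nonConstant? (MUX n) (s ++ x) (t ++ y)))

-- The monotone formula, its value and its size.

module _ {m : ℕ} where

  -- The constant true is not a formula, so a term that is not at s carries
  -- its conjunction of t-variables as a prefix P.
  prefixed : ∀ {n} → MonotoneFormula m → (Fin n → Fin m) →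
             (Vec Bool n → Bool) → (Vec Bool n → Fin m) → Vec Bool n → MonotoneFormula m
  prefixed P τ c υ []      = if c [] then P else P ∧ᶠ var (υ [])
  prefixed P τ c υ (b ∷ s) =
    prefixed P (τ ∘ suc) (c ∘ (b ∷_)) (υ ∘ (b ∷_)) s ∨ᶠ
    prefixed (P ∧ᶠ var (τ zero)) (τ ∘ suc) (c ∘ (not b ∷_)) (υ ∘ (not b ∷_)) s

  -- Follows the path without flips, which ends at `s` itself; as `c` will be false there, the leaf
  -- is a single variable. The first flip off this path starts the prefix.
  formula : ∀ {n} → (Fin n → Fin m) →
            (Vec Bool n → Bool) → (Vec Bool n → Fin m) → Vec Bool n → MonotoneFormula m
  formula τ c υ []      = var (υ [])
  formula τ c υ (b ∷ s) =
    formula (τ ∘ suc) (c ∘ (b ∷_)) (υ ∘ (b ∷_)) s ∨ᶠ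
    prefixed (var (τ zero)) (τ ∘ suc) (c ∘ (not b ∷_)) (υ ∘ (not b ∷_)) s

  -- Every term carries `P`, so `P` factors out by distributivity; the literal added at a flip
  -- becomes the guard `d` of the second branch.
  eval-prefixed : ∀ {n} P τ c υ (s t : Vec Bool n) v → (∀ i → lookup v (τ i) ≡ lookup t i) →
                  eval (prefixed P τ c υ s) v ≡
                  eval P v ∧ anyReachable s t (λ a → c a ∨ lookup v (υ a))
  eval-prefixed P τ c υ [] [] v h with c []
  ... | true  = sym (∧-identityʳ _)
  ... | false = refl
  eval-prefixed P τ c υ (b ∷ s) (d ∷ t) v h
    rewrite eval-prefixed P (τ ∘ suc) (c ∘ (b ∷_)) (υ ∘ (b ∷_)) s t v (h ∘ suc)
          | eval-prefixed (P ∧ᶠ var (τ zero)) (τ ∘ suc) (c ∘ (not b ∷_)) (υ ∘ (not b ∷_))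
                          s t v (h ∘ suc)
          | h zero
    = trans (cong (_ ∨_) (∧-assoc (eval P v) d _)) (sym (∧-distribˡ-∨ (eval P v) _ _))

  eval-formula : ∀ {n} τ c υ (s t : Vec Bool n) v → (∀ i → lookup v (τ i) ≡ lookup t i) →
                 c s ≡ false →
                 eval (formula τ c υ s) v ≡ anyReachable s t (λ a → c a ∨ lookup v (υ a))
  eval-formula τ c υ []      []      v h cs rewrite cs = refl
  eval-formula τ c υ (b ∷ s) (d ∷ t) v h cs
    rewrite eval-formula (τ ∘ suc) (c ∘ (b ∷_)) (υ ∘ (b ∷_)) s t v (h ∘ suc) cs
          | eval-prefixed (var (τ zero)) (τ ∘ suc) (c ∘ (not b ∷_)) (υ ∘ (not b ∷_))
                          s t v (h ∘ suc)
          | h zero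
    = refl

  -- Each of the `2 ^ n` terms has the leaves of `P`, at most `n` literals for flips, and at most
  -- one data variable.
  size-prefixed : ∀ {n} P τ c υ (s : Vec Bool n) →
                  size (prefixed P τ c υ s) ≤ (size P + suc n) * 2 ^ n
  size-prefixed P τ c υ [] rewrite *-identityʳ (size P + 1) with c []
  ... | true  = m≤m+n _ _
  ... | false = ≤-refl
  size-prefixed {suc n} P τ c υ (b ∷ s) = begin
    size (prefixed P _ _ _ s) + size (prefixed (P ∧ᶠ var (τ zero)) _ _ _ s)
      ≤⟨ +-mono-≤ (size-prefixed P _ _ _ s) (size-prefixed (P ∧ᶠ var (τ zero)) _ _ _ s) ⟩
    (size P + suc n) * 2 ^ n + (size P + 1 + suc n) * 2 ^ n
      -- The branch that keeps the bit adds no literal, so each of its `2 ^ n` terms has one leaf to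
      -- spare.
      ≤⟨ m≤m+n _ (2 ^ n) ⟩
    (size P + suc n) * 2 ^ n + (size P + 1 + suc n) * 2 ^ n + 2 ^ n
      ≡⟨ rearrange (size P) n (2 ^ n) ⟩
    (size P + suc (suc n)) * 2 ^ suc n ∎
    where
    open ≤-Reasoning
    rearrange : ∀ p n k → (p + suc n) * k + (p + 1 + suc n) * k + k ≡
                          (p + suc (suc n)) * (k + (k + 0))
    rearrange = solve-∀

  size-formula : ∀ {n} τ c υ (s : Vec Bool n) → size (formula τ c υ s) ≤ (n + 1) * 2 ^ n
  size-formula τ c υ [] = ≤-refl
  size-formula {suc n} τ c υ (b ∷ s) = begin
    size (formula _ _ _ s) + size (prefixed (var (τ zero)) _ _ _ s)
      ≤⟨ +-mono-≤ (size-formula _ _ _ s) (size-prefixed (var (τ zero)) _ _ _ s) ⟩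
    (n + 1) * 2 ^ n + (1 + suc n) * 2 ^ n
      -- Only the flipped half spends the extra literal; the other half is padded by one leaf per
      -- term.
      ≤⟨ m≤m+n _ (2 ^ n) ⟩
    (n + 1) * 2 ^ n + (1 + suc n) * 2 ^ n + 2 ^ n
      ≡⟨ rearrange n (2 ^ n) ⟩
    (suc n + 1) * 2 ^ suc n ∎
    where
    open ≤-Reasoning
    rearrange : ∀ n k → (n + 1) * k + (1 + suc n) * k + k ≡ (suc n + 1) * (k + (k + 0))
    rearrange = solve-∀

-- Instantiating the formula for the multiplexer.

anyReachable-cong : ∀ {n} (s t : Vec Bool n) {g h} → (∀ a → g a ≡ h a) →
                    anyReachable s t g ≡ anyReachable s t h
anyReachable-cong []      []      eq = eq []
anyReachable-cong (b ∷ s) (c ∷ t) eq =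
  cong₂ (λ u v → u ∨ (c ∧ v)) (anyReachable-cong s t (eq ∘ (b ∷_)))
                              (anyReachable-cong s t (eq ∘ (not b ∷_)))

proposition3p1 : (n : ℕ) → n ≥ 1 → (s : Vec Bool n) (x : Vec Bool (2 ^ n)) →
    Σ[ F ∈ MonotoneFormula (n + 2 ^ n) ] ((∀ (t : Vec Bool n) (y : Vec Bool (2 ^ n)) →
    eval F (t ++ y) ≡ hazardDerivative (MUX n) (s ++ x) (t ++ y))
    × size F ≤ (n + 1) * 2 ^ n)
proposition3p1 n _ s x =
  formula τ (differs s x) υ s , correct , size-formula τ (differs s x) υ s
  where
  τ : Fin n → Fin (n + 2 ^ n)
  τ i = i ↑ˡ 2 ^ n

  υ : Vec Bool n → Fin (n + 2 ^ n)
  υ a = n ↑ʳ address a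

  correct : ∀ t y → eval (formula τ (differs s x) υ s) (t ++ y) ≡
                    hazardDerivative (MUX n) (s ++ x) (t ++ y)
  correct t y = begin
    eval (formula τ (differs s x) υ s) (t ++ y)
      -- By `xor-same`, `s` does not differ from itself, which justifies the bare variable at the
      -- end of the path without flips.
      ≡⟨ eval-formula τ (differs s x) υ s t (t ++ y) (lookup-++ˡ t y)
                      (xor-same (lookup x (address s))) ⟩
    anyReachable s t (λ a → differs s x a ∨ lookup (t ++ y) (υ a))
      ≡⟨ anyReachable-cong s t (λ a → cong (differs s x a ∨_) (lookup-++ʳ t y (address a))) ⟩
    anyReachable s t (λ a → differs s x a ∨ lookup y (address a))
      ≡⟨ anyReachable≡hazardDerivative s t x y ⟩
    hazardDerivative (MUX n) (s ++ x) (t ++ y) ∎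
    where open ≡-Reasoning
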